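{- Let $G=(V,E)$ be a finite undirected, unweighted graph with $n=|V|$ and let $v_1,v_2,\ldots,v_n$ be any ordering of $V$. Let $L_0,\ldots,L_n$ be the indices built by naive landmark labeling and $L'_0,\ldots,L'_n$ the indices built by pruned landmark labeling, both with respect to this ordering. Then for any $0\le k\le n$ and any pair of vertices $s,t\in V$, $$\mathrm{Query}(s,t,L'_k)=\mathrm{Query}(s,t,L_k).$$
   Context: $d_G(u,v)$ is the shortest-path distance (number of edges) between $u$ and $v$ in $G$, with $d_G(u,v)=\infty$ if $u$ and $v$ are disconnected. $N_G(u)$ is the set of neighbors of $u$. An index $L$ assigns to each vertex $v$ a label $L(v)$, a finite set of pairs $(u,\delta_{uv})$ with $u\in V$ and $\delta_{uv}$ a distance value. For an index $L$, $$\mathrm{Query}(s,t,L)=\min\{\delta_{vs}+\delta_{vt}\mid (v,\delta_{vs})\in L(s),\ (v,\delta_{vt})\in L(t)\},$$ with value $\infty$ if $L(s)$ and $L(t)$ share no vertex. Naive landmark labeling: $L_0(u)=\emptyset$ for all $u\in V$. For $k=1,\ldots,n$: $L_k(u)=L_{k-1}(u)\cup\{(v_k,d_G(v_k,u))\}$ if $d_G(v_k,u)\neq\infty$, and $L_k(u)=L_{k-1}(u)$ otherwise. Pruned landmark labeling: $L'_0(u)=\emptyset$ for all $u\in V$. For $k=1,\ldots,n$, $L'_k$ is obtained from $L'_{k-1}$ by a pruned breadth-first search (BFS) from $v_k$: set $P[v_k]=0$ and $P[v]=\infty$ for all $v\neq v_k$, and start with a FIFO queue containing only $v_k$. While the queue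 is nonempty, dequeue a vertex $u$. If $\mathrm{Query}(v_k,u,L'_{k-1})\le P[u]$, then $u$ is pruned: nothing is added to its label and no edge from $u$ is traversed. Otherwise set $L'_k(u)=L'_{k-1}(u)\cup\{(v_k,P[u])\}$, and for every $w\in N_G(u)$ with $P[w]=\infty$ set $P[w]=P[u]+1$ and enqueue $w$. For every vertex $u$ that is pruned or not visited, $L'_k(u)=L'_{k-1}(u)$. -}

module Defs where

open import Data.Fin.Base as Fin using (Fin; zero; suc; toℕ; fromℕ<)
import Data.Fin.Properties as Fin
open import Data.List.Base using (List; []; _∷_; _++_; length; map; filter; foldl; cartesianProduct; tabulate)
open import Data.List.Extrema using (min)
open import Data.List.Membership.Propositional using (_∈_; lose; find)
open import Data.List.Membership.Propositional.Properties using (∈-tabulate⁺)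
open import Data.List.Properties using (length-++; length-filter; length-tabulate)
open import Data.List.Relation.Unary.Any using (here; there; any?)
open import Data.Maybe.Base using (zipWith)
open import Data.Nat.Base using (ℕ; zero; suc; _+_; _∸_; _≤_; _<_; z≤n; s≤s; s≤s⁻¹)
open import Data.Nat.GeneralisedArithmetic using (fold)
open import Data.Nat.Induction using (<-rec)
open import Data.Nat.Properties
open import Data.Product using (∃; _×_; _,_; proj₁; proj₂)
open import Data.Sum.Base using (_⊎_; inj₁; inj₂)
open import Function.Base using (_∘_)
open import Function.Bundles using (_⇔_; _↔_; Equivalence; Inverse)
open import Function.Properties.Inverse using (↔-sym; ↔⇒↣)
open import Level using (0ℓ)
open import Relation.Binary.Bundles using (TotalOrder)
open import Relation.Binary.Core using (Rel)
open import Relation.Binary.Definitions using (Symmetric; Decidable; DecidableEquality)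
import Relation.Binary.Construct.Add.Supremum.NonStrict as AddSupremum
open import Relation.Binary.PropositionalEquality using (_≡_; refl; sym; trans; cong; subst)
open import Relation.Nullary.Construct.Add.Supremum using (_⁺; ⊤⁺; [_]; ≡-dec)
open import Relation.Nullary.Decidable using (Dec; yes; no; map′; via-injection)
open import Relation.Nullary.Negation using (¬_; contradiction)

open AddSupremum _≤_ using (_≤⁺_; _≤⊤⁺; ≤⁺-dec; ≤⁺-isTotalOrder-≡)

ℕ∞ : Set
ℕ∞ = ℕ ⁺

pattern ∞ = ⊤⁺

infixl 6 _+∞_

_+∞_ : ℕ∞ → ℕ∞ → ℕ∞
_+∞_ = zipWith _+_

infix 4 _≤∞?_ _≟∞_

_≤∞?_ : Decidable _≤⁺_
_≤∞?_ = ≤⁺-dec _≤?_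

_≟∞_ : DecidableEquality ℕ∞
_≟∞_ = ≡-dec _≟_

ℕ∞-totalOrder : TotalOrder 0ℓ 0ℓ 0ℓ
ℕ∞-totalOrder = record { isTotalOrder = ≤⁺-isTotalOrder-≡ ≤-isTotalOrder }

-- The lists `neighbours u` enumerate the sets N_G(u).  Their order, which is
-- arbitrary, is the order in which a search scans the edges at u.
record Graph (V : Set) : Set₁ where
  infix 4 _~_
  field
    _~_          : Rel V 0ℓ
    ~-sym        : Symmetric _~_
    neighbours   : V → List V
    ∈-neighbours : ∀ {u w} → w ∈ neighbours u ⇔ u ~ w

module _ {V : Set} (G : Graph V) where
  open Graph G

  data Walk : V → V → ℕ → Set where
    []  : ∀ {u} → Walk u u 0
    _∷_ : ∀ {u w v ℓ} → u ~ w → Walk w v ℓ → Walk u v (suc ℓ)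

  IsDistance : V → V → ℕ∞ → Set
  IsDistance u v [ ℓ ] = Walk u v ℓ × (∀ m → Walk u v m → ℓ ≤ m)
  IsDistance u v ∞     = ∀ m → ¬ Walk u v m

-- The bijection `order` is the vertex ordering v₁, …, vₙ, indexed from 0; it
-- also expresses that V is finite with n elements.
module Labelling {V : Set} {n : ℕ} (G : Graph V) (order : Fin n ↔ V) where
  open Graph G

  private
    v⟨_⟩ : Fin n → V
    v⟨_⟩ = Inverse.to order

    index : V → Fin n
    index = Inverse.from order

  infix 4 _≟ⱽ_

  _≟ⱽ_ : DecidableEquality V
  _≟ⱽ_ = via-injection (↔⇒↣ (↔-sym order)) Fin._≟_

  private
    walk? : ∀ ℓ u v → Dec (Walk G u v ℓ)
    walk? zero u v = map′ (λ { refl → [] }) (λ { [] → refl }) (u ≟ⱽ v)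
    walk? (suc ℓ) u v = map′
      (λ p → let (_ , w∈ , q) = find p in Equivalence.to ∈-neighbours w∈ ∷ q)
      (λ { (e ∷ q) → lose (Equivalence.from ∈-neighbours e) q })
      (any? (λ w → walk? ℓ w v) (neighbours u))

    vertexAt : ∀ {u v ℓ} → Walk G u v ℓ → Fin (suc ℓ) → V
    vertexAt {u} _   zero    = u
    vertexAt (_ ∷ p) (suc i) = vertexAt p i

    before : ∀ {u v ℓ} (p : Walk G u v ℓ) i → Walk G u (vertexAt p i) (toℕ i)
    before _       zero    = []
    before (e ∷ p) (suc i) = e ∷ before p i

    after : ∀ {u v ℓ} (p : Walk G u v ℓ) i → Walk G (vertexAt p i) v (ℓ ∸ toℕ i)
    after p       zero    = p
    after (_ ∷ p) (suc i) = after p i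

    _++ʷ_ : ∀ {u v w k ℓ} → Walk G u v k → Walk G v w ℓ → Walk G u w (k + ℓ)
    []      ++ʷ q = q
    (e ∷ p) ++ʷ q = e ∷ (p ++ʷ q)

    shorten : ∀ {u v ℓ} → Walk G u v ℓ → n ≤ ℓ → ∃ λ m → m < ℓ × Walk G u v m
    shorten {u} {v} {ℓ} p n≤ℓ
      with i , j , i<j , eq ← Fin.pigeonhole (s≤s n≤ℓ) (index ∘ vertexAt p)
      = toℕ i + (ℓ ∸ toℕ j)
      , <-≤-trans (+-monoˡ-< (ℓ ∸ toℕ j) i<j)
                  (≤-reflexive (m+[n∸m]≡n (Fin.toℕ≤pred[n] j)))
      , (before p i ++ʷ subst (λ x → Walk G x v (ℓ ∸ toℕ j)) (sym same) (after p j))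
      where
      same : vertexAt p i ≡ vertexAt p j
      same = trans (sym (Inverse.strictlyInverseˡ order _))
                   (trans (cong v⟨_⟩ eq) (Inverse.strictlyInverseˡ order _))

    least : ∀ {P : ℕ → Set} → (∀ m → Dec (P m)) → ∀ b →
            (∃ λ m → P m × (∀ j → j < m → ¬ P j)) ⊎ (∀ j → j < b → ¬ P j)
    least P? zero = inj₂ λ _ ()
    least {P} P? (suc b) with least P? b
    ... | inj₁ found = inj₁ found
    ... | inj₂ none with P? b
    ...   | yes pb = inj₁ (b , pb , none)
    ...   | no ¬pb = inj₂ λ j j<1+b → case-≤ j (m≤n⇒m<n∨m≡n (s≤s⁻¹ j<1+b))
      where
      case-≤ : ∀ j → j < b ⊎ j ≡ b → ¬ P j
      case-≤ j (inj₁ j<b)  = none j j<b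
      case-≤ j (inj₂ refl) = ¬pb

  distance : ∀ u v → ∃ (IsDistance G u v)
  distance u v with least (λ ℓ → walk? ℓ u v) n
  ... | inj₁ (ℓ , p , below) = [ ℓ ] , p , λ m q → ≮⇒≥ λ m<ℓ → below m m<ℓ q
  ... | inj₂ none = ∞ , <-rec _ noWalk
    where
    noWalk : ∀ m → (∀ {k} → k < m → ¬ Walk G u v k) → ¬ Walk G u v m
    noWalk m rec p with m <? n
    ... | yes m<n = none m m<n p
    ... | no m≮n  = let (_ , k<m , q) = shorten p (≮⇒≥ m≮n) in rec k<m q

  d : V → V → ℕ∞
  d u v = proj₁ (distance u v)

  -- Lists stand for finite sets of pairs.
  Index : Set
  Index = V → List (V × ℕ∞)

  sameVertex? : (p : (V × ℕ∞) × (V × ℕ∞)) → Dec (proj₁ (proj₁ p) ≡ proj₁ (proj₂ p))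
  sameVertex? ((v , _) , (w , _)) = v ≟ⱽ w

  sumδ : (V × ℕ∞) × (V × ℕ∞) → ℕ∞
  sumδ ((_ , δ) , (_ , δ′)) = δ +∞ δ′

  Query : V → V → Index → ℕ∞
  Query s t L =
    min ℕ∞-totalOrder ∞
      (map sumδ (filter sameVertex? (cartesianProduct (L s) (L t))))

  _[_≔_] : ∀ {A : Set} → (V → A) → V → A → V → A
  (f [ u ≔ a ]) w with w ≟ⱽ u
  ... | yes _ = a
  ... | no  _ = f w

  build : (V → Index → Index) → ∀ k → .(k ≤ n) → Index
  build extend zero    _   = λ _ → []
  build extend (suc k) k<n = extend v⟨ fromℕ< k<n ⟩ (build extend k (<⇒≤ k<n))

  addLandmark : V → Index → Index
  addLandmark r L u with d r u
  ... | [ ℓ ] = (r , [ ℓ ]) ∷ L u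
  ... | ∞     = L u

  naive : ∀ k → .(k ≤ n) → Index
  naive = build addLandmark

  record State : Set where
    constructor state
    field
      P      : V → ℕ∞
      queue  : List V
      labels : Index

  open State

  discover : ℕ∞ → State → V → State
  discover δ (state P q L′) w with P w
  ... | [ _ ] = state P q L′
  ... | ∞     = state (P [ w ≔ δ ]) (q ++ w ∷ []) L′

  -- One iteration of the loop of the pruned search from r; L is the index
  -- before the search, against which pruning is tested throughout.
  step : V → Index → State → State
  step r L (state P []      L′) = state P [] L′
  step r L (state P (u ∷ q) L′) with Query r u L ≤∞? P u
  ... | yes _ = state P q L′
  ... | no  _ = foldl (discover (P u +∞ [ 1 ]))
                      (state P q (L′ [ u ≔ (r , P u) ∷ L′ u ]))
                      (neighbours u)

  start : V → Index → State
  start r L = state ((λ _ → ∞) [ r ≔ [ 0 ] ]) (r ∷ []) L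

  -- No vertex is enqueued twice, so n iterations exhaust the queue
  -- (`search-terminates`), after which `step` does nothing.
  search : V → Index → State
  search r L = fold (start r L) (step r L) n

  prunedBFS : V → Index → Index
  prunedBFS r L = labels (search r L)

  pruned : ∀ k → .(k ≤ n) → Index
  pruned = build prunedBFS

  private
    count∞ : (V → ℕ∞) → List V → ℕ
    count∞ P vs = length (filter (λ v → P v ≟∞ ∞) vs)

    vertices : List V
    vertices = tabulate v⟨_⟩

    ∈-vertices : ∀ w → w ∈ vertices
    ∈-vertices w = subst (_∈ vertices) (Inverse.strictlyInverseˡ order w) (∈-tabulate⁺ (index w))

    count-≔-≤ : ∀ P w ℓ vs → count∞ (P [ w ≔ [ ℓ ] ]) vs ≤ count∞ P vs
    count-≔-≤ P w ℓ [] = z≤n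
    count-≔-≤ P w ℓ (x ∷ vs) with x ≟ⱽ w
    ... | yes _ with P x
    ...   | ∞     = m≤n⇒m≤1+n (count-≔-≤ P w ℓ vs)
    ...   | [ _ ] = count-≔-≤ P w ℓ vs
    count-≔-≤ P w ℓ (x ∷ vs) | no _ with P x
    ...   | ∞     = s≤s (count-≔-≤ P w ℓ vs)
    ...   | [ _ ] = count-≔-≤ P w ℓ vs

    count-≔-< : ∀ P w ℓ vs → w ∈ vs → P w ≡ ∞ → count∞ (P [ w ≔ [ ℓ ] ]) vs < count∞ P vs
    count-≔-< P w ℓ (x ∷ vs) (here refl) eq with x ≟ⱽ x
    ... | no x≢x = contradiction refl x≢x
    ... | yes _ rewrite eq = s≤s (count-≔-≤ P w ℓ vs)
    count-≔-< P w ℓ (x ∷ vs) (there w∈) eq with x ≟ⱽ w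
    ... | yes refl rewrite eq = s≤s (count-≔-≤ P w ℓ vs)
    ... | no _ with P x
    ...   | ∞     = s≤s (count-≔-< P w ℓ vs w∈ eq)
    ...   | [ _ ] = count-≔-< P w ℓ vs w∈ eq

    potential : State → ℕ
    potential S = length (queue S) + count∞ (P S) vertices

    discover-≤ : ∀ ℓ S w → potential (discover [ ℓ ] S w) ≤ potential S
    discover-≤ ℓ (state P q L′) w with P w in eq
    ... | [ _ ] = ≤-refl
    ... | ∞ rewrite length-++ q {w ∷ []} | +-assoc (length q) 1 (count∞ (P [ w ≔ [ ℓ ] ]) vertices)
      = +-monoʳ-≤ (length q) (count-≔-< P w ℓ vertices (∈-vertices w) eq)

    foldl-discover-≤ : ∀ ℓ S ws → potential (foldl (discover [ ℓ ]) S ws) ≤ potential S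
    foldl-discover-≤ ℓ S []       = ≤-refl
    foldl-discover-≤ ℓ S (w ∷ ws) =
      ≤-trans (foldl-discover-≤ ℓ (discover [ ℓ ] S w) ws) (discover-≤ ℓ S w)

    step-decreases : ∀ r L S → queue (step r L S) ≡ [] ⊎ potential (step r L S) < potential S
    step-decreases r L (state P [] L′) = inj₁ refl
    step-decreases r L (state P (u ∷ q) L′) with Query r u L ≤∞? P u
    ... | yes _ = inj₂ ≤-refl
    ... | no Q≰ with P u
    ...   | ∞     = contradiction (Query r u L ≤⊤⁺) Q≰
    ...   | [ ℓ ] = inj₂ (s≤s (foldl-discover-≤ (ℓ + 1) _ (neighbours u)))

    step-done : ∀ r L S → queue S ≡ [] → queue (step r L S) ≡ []
    step-done r L (state _ [] _) refl = refl

    start-≤ : ∀ r L → potential (start r L) ≤ n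
    start-≤ r L = ≤-trans
      (count-≔-< (λ _ → ∞) r 0 vertices (∈-vertices r) refl)
      (≤-trans (length-filter _ vertices) (≤-reflexive (length-tabulate v⟨_⟩)))

    progress : ∀ r L m → let S = fold (start r L) (step r L) m in
               queue S ≡ [] ⊎ m + potential S ≤ n
    progress r L zero = inj₂ (start-≤ r L)
    progress r L (suc m) with progress r L m | step-decreases r L (fold (start r L) (step r L) m)
    ... | inj₁ done | _         = inj₁ (step-done r L _ done)
    ... | inj₂ _    | inj₁ done = inj₁ done
    ... | inj₂ le   | inj₂ lt   = inj₂ (≤-trans (≤-reflexive (sym (+-suc m _)))
                                                (≤-trans (+-monoʳ-≤ m lt) le))

  search-terminates : ∀ r L → queue (search r L) ≡ []
  search-terminates r L with progress r L n
  ... | inj₁ done = done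
  ... | inj₂ le with queue (search r L)
  ...   | []    = refl
  ...   | _ ∷ q = contradiction (≤-trans (+-monoʳ-≤ n (s≤s z≤n)) le) (m+1+n≰m n)

{-# OPTIONS --safe #-}

-- Say that a landmark v is a hub of s and t of length c when there are walks from
-- v to s and to t of total length at most c.  Every label records the length of a
-- walk from a landmark, so a query never undercuts the hubs.  Conversely, by
-- induction on k, every hub is matched by a query.  Consider the search from a new
-- landmark r.  If it does not label a vertex u with a distance at most the length a
-- of a given walk from r to u, then it was pruned at some vertex of this walk, so by
-- induction there is an old hub of that vertex and r, which, following the walk
-- further, is a hub of u and r of length at most a.  Hence whenever r is a hub of
-- s and t, either both endpoints carry a label for r, or an old landmark is a hub of
-- s and t of the same length.  Naive labelling is the case in which nothing is pruned.

module Submission where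

open import Defs
open import Data.Fin.Base using (Fin; fromℕ<)
open import Data.List.Base using (List; []; _∷_; _++_; foldl)
open import Data.List.Extrema ℕ∞-totalOrder using (argmin-sel; min≤v⁺)
open import Data.List.Membership.Propositional using (_∈_; lose)
open import Data.List.Membership.Propositional.Properties
  using (∈-map∘filter⁺; ∈-map∘filter⁻; ∈-cartesianProduct⁺; ∈-cartesianProduct⁻; ∈-++⁺ˡ; ∈-++⁺ʳ)
open import Data.List.Relation.Unary.Any using (here; there)
open import Data.Nat.Base using (ℕ; zero; suc; _+_; _≤_; z≤n; s≤s)
open import Data.Nat.GeneralisedArithmetic using (fold)
open import Data.Nat.Properties
open import Data.Product using (∃; ∃₂; _×_; _,_)
open import Data.Sum.Base using (_⊎_; inj₁; inj₂)
open import Function.Base using (_∘_)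
open import Function.Bundles using (_↔_; Equivalence; Inverse)
open import Relation.Binary.PropositionalEquality using (_≡_; refl; sym; trans; subst)
import Relation.Binary.Construct.Add.Supremum.NonStrict as AddSupremum
open import Relation.Nullary.Construct.Add.Supremum using ([_])
open import Relation.Nullary.Decidable using (yes; no)
open import Relation.Nullary.Negation using (contradiction)

open AddSupremum _≤_ using (_≤⁺_; _≤⊤⁺; ≤⁺-antisym-≡; [≤]-injective)
  renaming ([_] to lift-≤)

-- Extended naturals and walks.

[]-injective : ∀ {a b : ℕ} → _≡_ {A = ℕ∞} [ a ] [ b ] → a ≡ b
[]-injective refl = refl

-- The bound `∞` is free, so only finite `c` need testing. Queries can thus be compared at the
-- finite lengths for which hubs are defined.
≤⁺-from-bounds : ∀ {x y} → (∀ c → y ≤⁺ [ c ] → x ≤⁺ [ c ]) → x ≤⁺ y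
≤⁺-from-bounds {y = [ c ]} f = f c (lift-≤ ≤-refl)
≤⁺-from-bounds {y = ∞}     f = _ ≤⊤⁺

module _ {V : Set} {G : Graph V} where
  open Graph G

  infixr 5 _++ʷ_

  _++ʷ_ : ∀ {u v w k ℓ} → Walk G u v k → Walk G v w ℓ → Walk G u w (k + ℓ)
  []      ++ʷ q = q
  (e ∷ p) ++ʷ q = e ∷ (p ++ʷ q)

module Correctness {V : Set} {n : ℕ} (G : Graph V) (order : Fin n ↔ V) where
  open Graph G
  open Labelling G order
  open State

  -- Updates and queries.

  ≔-hit : ∀ {A : Set} (f : V → A) u {a} → (f [ u ≔ a ]) u ≡ a
  ≔-hit f u with u ≟ⱽ u
  ... | yes _  = refl
  ... | no u≢u = contradiction refl u≢u

  query⁺ : ∀ {L s t v δ δ′ c} → (v , δ) ∈ L s → (v , δ′) ∈ L t →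
           δ +∞ δ′ ≤⁺ [ c ] → Query s t L ≤⁺ [ c ]
  query⁺ δ∈ δ′∈ le = min≤v⁺ ∞ _ (inj₂ (lose
    (∈-map∘filter⁺ sumδ sameVertex? (_ , ∈-cartesianProduct⁺ δ∈ δ′∈ , refl , refl)) le))

  query⁻ : ∀ {L s t c} → Query s t L ≤⁺ [ c ] →
           ∃ λ v → ∃₂ λ δ δ′ → (v , δ) ∈ L s × (v , δ′) ∈ L t × δ +∞ δ′ ≤⁺ [ c ]
  query⁻ {L} {s} {t} le with argmin-sel (λ x → x) ∞ _
  -- The minimum is either the default `∞`, which no finite bound allows, or an entry of the list.
  ... | inj₁ eq = contradiction (subst (_≤⁺ _) eq le) λ ()
  ... | inj₂ min∈ with ∈-map∘filter⁻ sumδ sameVertex? min∈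
  ...   | ((v , δ) , (_ , δ′)) , pair∈ , eq , refl =
    let (δ∈ , δ′∈) = ∈-cartesianProduct⁻ (L s) (L t) pair∈
    in v , δ , δ′ , δ∈ , δ′∈ , subst (_≤⁺ _) eq le

  infix 4 _⊆ᴸ_

  _⊆ᴸ_ : Index → Index → Set
  L ⊆ᴸ L′ = ∀ {u x} → x ∈ L u → x ∈ L′ u

  query-anti : ∀ {L L′ s t c} → L ⊆ᴸ L′ → Query s t L ≤⁺ [ c ] → Query s t L′ ≤⁺ [ c ]
  query-anti {L} {L′} L⊆L′ le with query⁻ {L} le
  ... | _ , _ , _ , δ∈ , δ′∈ , le′ = query⁺ {L′} (L⊆L′ δ∈) (L⊆L′ δ′∈) le′

  -- Hubs and correctness of an index.

  record Hub (A : V → Set) (s t : V) (c : ℕ) : Set where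
    constructor hub
    field
      {v}     : V
      v∈A     : A v
      {a b}   : ℕ
      to-s    : Walk G v s a
      to-t    : Walk G v t b
      a+b≤c   : a + b ≤ c

  hub-sym : ∀ {A s t c} → Hub A s t c → Hub A t s c
  hub-sym (hub v∈A {a} {b} p q le) = hub v∈A q p (≤-trans (≤-reflexive (+-comm b a)) le)

  hub-mono : ∀ {A s t c d} → c ≤ d → Hub A s t c → Hub A s t d
  hub-mono c≤d (hub v∈A p q le) = hub v∈A p q (≤-trans le c≤d)

  hub-extend : ∀ {A s u t c d} → Hub A s u c → Walk G u t d → Hub A s t (c + d)
  hub-extend {d = d} (hub v∈A {a} {b} p q le) w =
    hub v∈A p (q ++ʷ w) (≤-trans (≤-reflexive (sym (+-assoc a b d))) (+-monoˡ-≤ d le))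

  -- Labels need only be lengths of walks, not distances; no separate proof that the search finds
  -- shortest walks is then required.
  Sound : (V → Set) → Index → Set
  Sound A L = ∀ {u v δ} → (v , δ) ∈ L u → A v × ∃ λ ℓ → δ ≡ [ ℓ ] × Walk G v u ℓ

  Complete : (V → Set) → Index → Set
  Complete A L = ∀ {s t c} → Hub A s t c → Query s t L ≤⁺ [ c ]

  Correct : (V → Set) → Index → Set
  Correct A L = Sound A L × Complete A L

  hub-from-query : ∀ {A L s t c} → Sound A L → Query s t L ≤⁺ [ c ] → Hub A s t c
  hub-from-query {L = L} sound le with query⁻ {L} le
  ... | v , δ , δ′ , δ∈ , δ′∈ , le′ with sound δ∈ | sound δ′∈
  ...   | v∈A , _ , refl , p | _ , _ , refl , q = hub v∈A p q ([≤]-injective le′)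

  -- For a correct index, the finite upper bounds of a query are exactly the lengths of hubs, and
  -- these depend on `A` alone.
  correct-unique : ∀ {A L L′} → Correct A L → Correct A L′ → ∀ s t → Query s t L ≡ Query s t L′
  correct-unique {L = L} {L′} (sound , complete) (sound′ , complete′) s t =
    ≤⁺-antisym-≡ ≤-antisym
      (≤⁺-from-bounds λ _ → complete  ∘ hub-from-query {L = L′} sound′)
      (≤⁺-from-bounds λ _ → complete′ ∘ hub-from-query {L = L} sound)

  -- Adding one landmark.

  _∪⟨_⟩ : (V → Set) → V → V → Set
  (A ∪⟨ r ⟩) v = v ≡ r ⊎ A v

  sound-weaken : ∀ {A r L} → Sound A L → Sound (A ∪⟨ r ⟩) L
  sound-weaken sound x∈ = let (v∈A , rest) = sound x∈ in inj₂ v∈A , rest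

  -- The second alternative is what pruning leaves behind: no suitable label for `r`, but an older
  -- landmark that does as well as the walk.
  Covers : (V → Set) → V → Index → Set
  Covers A r L′ = ∀ {u a} → Walk G r u a → (∃ λ ℓ → ℓ ≤ a × (r , [ ℓ ]) ∈ L′ u) ⊎ Hub A r u a

  covers-complete : ∀ {A r L L′} → Complete A L → L ⊆ᴸ L′ → Covers A r L′ →
                    Complete (A ∪⟨ r ⟩) L′
  covers-complete {L = L} {L′} complete L⊆L′ covers (hub (inj₂ v∈A) p q le) =
    query-anti {L} {L′} L⊆L′ (complete (hub v∈A p q le))
  covers-complete {L = L} {L′} complete L⊆L′ covers (hub (inj₁ refl) {a} {b} p q le)
    with covers p | covers q
  ... | inj₁ (_ , ℓ≤a , ℓ∈) | inj₁ (_ , ℓ′≤b , ℓ′∈) =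
    query⁺ {L′} ℓ∈ ℓ′∈ (lift-≤ (≤-trans (+-mono-≤ ℓ≤a ℓ′≤b) le))
  -- The old hub of `r` and `s` becomes one of `s` and `t` by appending the walk `q` at its end `r`;
  -- the next case does the same with `p`.
  ... | inj₂ h | _ =
    query-anti {L} {L′} L⊆L′ (complete (hub-mono le (hub-extend (hub-sym h) q)))
  ... | inj₁ _ | inj₂ h =
    query-anti {L} {L′} L⊆L′ (complete (hub-sym (hub-mono
      (≤-trans (≤-reflexive (+-comm b a)) le) (hub-extend (hub-sym h) p))))

  -- The recursion mirrors `build`, so both unfold together in `build-correct`; `Fin 0` serves as
  -- the empty type.
  Landmark : ∀ k → .(k ≤ n) → V → Set
  Landmark zero    _   = λ _ → Fin 0
  Landmark (suc k) k<n = Landmark k (<⇒≤ k<n) ∪⟨ Inverse.to order (fromℕ< k<n) ⟩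

  build-correct : ∀ {extend} → (∀ {A r L} → Correct A L → Correct (A ∪⟨ r ⟩) (extend r L)) →
                  ∀ k .(k≤n : k ≤ n) → Correct (Landmark k k≤n) (build extend k k≤n)
  build-correct extends zero    _   = (λ ()) , λ { (hub () _ _ _) }
  build-correct extends (suc k) k<n = extends (build-correct extends k (<⇒≤ k<n))

  -- Naive labelling.

  d-correct : ∀ u v → IsDistance G u v (d u v)
  d-correct u v = let (_ , isDistance) = distance u v in isDistance

  addLandmark-correct : ∀ {A r L} → Correct A L → Correct (A ∪⟨ r ⟩) (addLandmark r L)
  addLandmark-correct {A} {r} {L} (sound , complete) =
    sound′ , covers-complete {L = L} {addLandmark r L} complete L⊆L′ covers
    where
    sound′ : Sound (A ∪⟨ r ⟩) (addLandmark r L)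
    sound′ {u} x∈ with d r u | d-correct r u
    sound′ (here refl) | [ ℓ ] | p , _ = inj₁ refl , ℓ , refl , p
    sound′ (there x∈)  | [ _ ] | _     = sound-weaken {L = L} sound x∈
    sound′ x∈          | ∞     | _     = sound-weaken {L = L} sound x∈

    L⊆L′ : L ⊆ᴸ addLandmark r L
    L⊆L′ {u} x∈ with d r u
    ... | [ _ ] = there x∈
    ... | ∞     = x∈

    covers : Covers A r (addLandmark r L)
    covers {u} {a} p with d r u | d-correct r u
    ... | [ ℓ ] | _ , least = inj₁ (ℓ , least a p , here refl)
    ... | ∞     | noWalk    = contradiction p (noWalk a)

  -- Tentative distances and the queue.

  data Sorted (P : V → ℕ∞) : ℕ → List V → Set where
    []  : ∀ {lo} → Sorted P lo []
    _∷_ : ∀ {lo w a q} → P w ≡ [ a ] × lo ≤ a → Sorted P a q → Sorted P lo (w ∷ q)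

  infix 4 _⊑_

  _⊑_ : (P P′ : V → ℕ∞) → Set
  P ⊑ P′ = ∀ {w p} → P w ≡ [ p ] → P′ w ≡ [ p ]

  Bounded : (V → ℕ∞) → ℕ → Set
  Bounded P b = ∀ {w p} → P w ≡ [ p ] → p ≤ b

  sorted-⊑ : ∀ {P P′ lo q} → P ⊑ P′ → Sorted P lo q → Sorted P′ lo q
  sorted-⊑ P⊑P′ []                = []
  sorted-⊑ P⊑P′ ((eq , le) ∷ pqs) = (P⊑P′ eq , le) ∷ sorted-⊑ P⊑P′ pqs

  -- As `b` bounds every tentative distance, it also bounds that of the last queued vertex.
  sorted-snoc : ∀ {P lo q w b} → Bounded P b → lo ≤ b → P w ≡ [ b ] →
                Sorted P lo q → Sorted P lo (q ++ w ∷ [])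
  sorted-snoc bounded lo≤b eq []                 = (eq , lo≤b) ∷ []
  sorted-snoc bounded lo≤b eq ((eq′ , le) ∷ pqs) =
    (eq′ , le) ∷ sorted-snoc bounded (bounded eq′) eq pqs

  -- The FIFO discipline keeps all tentative distances within one of the head's.
  record Frontier (lo : ℕ) (S : State) : Set where
    field
      sorted  : Sorted (P S) lo (queue S)
      bounded : Bounded (P S) (suc lo)

  -- This summary of an edge scan composes along the fold, so the invariant proof never looks at the
  -- order of `ws`.
  record Explored (m : ℕ) (ws : List V) (S S′ : State) : Set where
    field
      kept    : P S ⊑ P S′
      fresh   : ∀ {w p} → P S′ w ≡ [ p ] → P S w ≡ [ p ] ⊎ (p ≡ m × w ∈ ws × w ∈ queue S′)
      queued  : ∀ {w} → w ∈ queue S → w ∈ queue S′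
      reached : ∀ {w} → w ∈ ws → ∃ λ p → P S′ w ≡ [ p ]
      labels≡ : labels S′ ≡ labels S

  ≔-⊑ : ∀ {P w δ} → P w ≡ ∞ → P ⊑ P [ w ≔ δ ]
  ≔-⊑ {w = w} eq {x} eq′ with x ≟ⱽ w
  ... | no _     = eq′
  ... | yes refl = contradiction (trans (sym eq) eq′) λ ()

  ≔-inv : ∀ {P w m x p} → (P [ w ≔ [ m ] ]) x ≡ [ p ] → P x ≡ [ p ] ⊎ (p ≡ m × x ≡ w)
  ≔-inv {w = w} {x = x} eq with x ≟ⱽ w
  ... | no _    = inj₁ eq
  ... | yes x≡w = inj₂ (sym ([]-injective eq) , x≡w)

  discover-explored : ∀ m S w → Explored m (w ∷ []) S (discover [ m ] S w)
  discover-explored m (state P q L′) w with P w in eq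
  ... | [ ℓ ] = record
    { kept    = λ eq′ → eq′
    ; fresh   = inj₁
    ; queued  = λ x∈ → x∈
    ; reached = λ { (here refl) → ℓ , eq }
    ; labels≡ = refl
    }
  ... | ∞ = record
    { kept    = ≔-⊑ eq
    ; fresh   = fresh′
    ; queued  = ∈-++⁺ˡ
    ; reached = λ { (here refl) → m , ≔-hit P w }
    ; labels≡ = refl
    }
    where
    fresh′ : ∀ {x p} → (P [ w ≔ [ m ] ]) x ≡ [ p ] →
             P x ≡ [ p ] ⊎ (p ≡ m × x ∈ w ∷ [] × x ∈ q ++ w ∷ [])
    fresh′ eq′ with ≔-inv eq′
    ... | inj₁ eq″           = inj₁ eq″
    ... | inj₂ (p≡m , refl) = inj₂ (p≡m , here refl , ∈-++⁺ʳ q (here refl))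

  discover-frontier : ∀ {lo} S w → Frontier lo S → Frontier lo (discover [ suc lo ] S w)
  discover-frontier {lo} (state P q L′) w F with P w in eq
  ... | [ _ ] = F
  ... | ∞     = record
    { sorted  = sorted-snoc bounded′ (n≤1+n lo) (≔-hit P w) (sorted-⊑ (≔-⊑ eq) sorted)
    ; bounded = bounded′
    }
    where
    open Frontier F
    bounded′ : Bounded (P [ w ≔ [ suc lo ] ]) (suc lo)
    bounded′ eq′ with ≔-inv eq′
    ... | inj₁ eq″        = bounded eq″
    ... | inj₂ (refl , _) = ≤-refl

  explored-∷ : ∀ {m w ws S S′ S″} → Explored m (w ∷ []) S S′ → Explored m ws S′ S″ →
               Explored m (w ∷ ws) S S″
  explored-∷ {m} {w} {ws} {S} {S′} {S″} E E′ = record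
    { kept    = E′.kept ∘ E.kept
    ; fresh   = fresh′
    ; queued  = E′.queued ∘ E.queued
    ; reached = reached′
    ; labels≡ = trans E′.labels≡ E.labels≡
    }
    where
    module E  = Explored E
    module E′ = Explored E′
    fresh′ : ∀ {x p} → P S″ x ≡ [ p ] → P S x ≡ [ p ] ⊎ (p ≡ m × x ∈ w ∷ ws × x ∈ queue S″)
    fresh′ eq with E′.fresh eq
    ... | inj₂ (p≡m , x∈ , x∈q) = inj₂ (p≡m , there x∈ , x∈q)
    ... | inj₁ eq′ with E.fresh eq′
    ...   | inj₁ eq″                   = inj₁ eq″
    ...   | inj₂ (p≡m , here x≡ , x∈q) = inj₂ (p≡m , here x≡ , E′.queued x∈q)
    reached′ : ∀ {x} → x ∈ w ∷ ws → ∃ λ p → P S″ x ≡ [ p ]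
    reached′ (here refl) = let (p , eq) = E.reached (here refl) in p , E′.kept eq
    reached′ (there x∈)  = E′.reached x∈

  foldl-explored : ∀ m S ws → Explored m ws S (foldl (discover [ m ]) S ws)
  foldl-explored m S [] = record
    { kept    = λ eq → eq
    ; fresh   = inj₁
    ; queued  = λ x∈ → x∈
    ; reached = λ ()
    ; labels≡ = refl
    }
  foldl-explored m S (w ∷ ws) =
    explored-∷ (discover-explored m S w) (foldl-explored m (discover [ m ] S w) ws)

  foldl-frontier : ∀ {lo} S ws → Frontier lo S → Frontier lo (foldl (discover [ suc lo ]) S ws)
  foldl-frontier S []       F = F
  foldl-frontier S (w ∷ ws) F = foldl-frontier _ ws (discover-frontier S w F)

  -- Invariant of the pruned search.

  module PrunedSearch {A : V → Set} (r : V) (L : Index) (sound : Sound A L) where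

    -- The bound `p′ ≤ suc p` is edge relaxation; iterated along a walk, it bounds the tentative
    -- distance at the end by the length of the walk.
    Expanded : State → V → ℕ → Set
    Expanded S w p = (r , [ p ]) ∈ labels S w ×
                     (∀ {x} → w ~ x → ∃ λ p′ → P S x ≡ [ p′ ] × p′ ≤ suc p)

    -- `settled` sorts the discovered vertices into waiting, expanded and pruned ones; once the
    -- queue is empty only the last two kinds remain.
    record Invariant (S : State) : Set where
      field
        {lo}         : ℕ
        frontier     : Frontier lo S
        source       : P S r ≡ [ 0 ]
        walks        : ∀ {w p} → P S w ≡ [ p ] → Walk G r w p
        labels-sound : Sound (A ∪⟨ r ⟩) (labels S)
        labels-⊇     : L ⊆ᴸ labels S
        settled      : ∀ {w p} → P S w ≡ [ p ] →
                       w ∈ queue S ⊎ Expanded S w p ⊎ Query r w L ≤⁺ [ p ]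

    start-invariant : Invariant (start r L)
    start-invariant = record
      { frontier     = record { sorted = (source , z≤n) ∷ [] ; bounded = bounded }
      ; source       = source
      ; walks        = walks
      ; labels-sound = sound-weaken {L = L} sound
      ; labels-⊇     = λ x∈ → x∈
      ; settled      = settled
      }
      where
      P₀ : V → ℕ∞
      P₀ = (λ _ → ∞) [ r ≔ [ 0 ] ]
      source : P₀ r ≡ [ 0 ]
      source = ≔-hit _ r
      only-r : ∀ {w p} → P₀ w ≡ [ p ] → p ≡ 0 × w ≡ r
      only-r eq with ≔-inv eq
      ... | inj₂ eqs = eqs
      bounded : ∀ {b} → Bounded P₀ b
      bounded eq with refl , _ ← only-r eq = z≤n
      walks : ∀ {w p} → P₀ w ≡ [ p ] → Walk G r w p
      walks eq with refl , refl ← only-r eq = []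
      settled : ∀ {w p} → P₀ w ≡ [ p ] →
                w ∈ r ∷ [] ⊎ Expanded (start r L) w p ⊎ Query r w L ≤⁺ [ p ]
      settled eq with _ , refl ← only-r eq = inj₁ (here refl)

    step-invariant : ∀ S → Invariant S → Invariant (step r L S)
    step-invariant (state P [] L′) I = I
    step-invariant (state P (u ∷ q) L′) I with Invariant.frontier I
    ... | record { sorted = _∷_ {a = a} (Pu≡a , lo≤a) sorted ; bounded = bounded }
      with Query r u L ≤∞? P u
    ... | yes Q≤Pu = record
      { Invariant I hiding (lo; frontier; settled)
      -- The new `lo` is the distance `a` of the dequeued head.
      ; frontier = record { sorted = sorted ; bounded = λ eq → ≤-trans (bounded eq) (s≤s lo≤a) }
      ; settled  = settled′
      }
      where
      settled′ : ∀ {w p} → P w ≡ [ p ] →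
                 w ∈ q ⊎ Expanded (state P q L′) w p ⊎ Query r w L ≤⁺ [ p ]
      settled′ eq with Invariant.settled I eq
      ... | inj₁ (here refl) = inj₂ (inj₂ (subst (_ ≤⁺_) eq Q≤Pu))
      ... | inj₁ (there w∈)  = inj₁ w∈
      ... | inj₂ done        = inj₂ done
    ... | no _ rewrite Pu≡a | +-comm a 1 = record
      { frontier     = F₂
      ; source       = E.kept I.source
      ; walks        = walks′
      ; labels-sound = subst (Sound _) (sym E.labels≡) sound₁
      ; labels-⊇     = subst (L ⊆ᴸ_) (sym E.labels≡) (L′⊆L₁ ∘ I.labels-⊇)
      ; settled      = settled′
      }
      where
      module I = Invariant I
      L₁ : Index
      L₁ = L′ [ u ≔ (r , [ a ]) ∷ L′ u ]
      S₁ S₂ : State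
      S₁ = state P q L₁
      S₂ = foldl (discover [ suc a ]) S₁ (neighbours u)
      module E = Explored (foldl-explored (suc a) S₁ (neighbours u))
      F₂ : Frontier a S₂
      F₂ = foldl-frontier S₁ (neighbours u)
        record { sorted = sorted ; bounded = λ eq → ≤-trans (bounded eq) (s≤s lo≤a) }
      sound₁ : Sound (A ∪⟨ r ⟩) L₁
      sound₁ {w} x∈ with w ≟ⱽ u
      sound₁ x∈          | no _     = I.labels-sound x∈
      sound₁ (here refl) | yes refl = inj₁ refl , a , refl , I.walks Pu≡a
      sound₁ (there x∈)  | yes refl = I.labels-sound x∈
      L′⊆L₁ : L′ ⊆ᴸ L₁
      L′⊆L₁ {w} x∈ with w ≟ⱽ u
      ... | no _     = x∈
      ... | yes refl = there x∈
      walks′ : ∀ {w p} → State.P S₂ w ≡ [ p ] → Walk G r w p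
      walks′ eq with E.fresh eq
      ... | inj₁ eq′            = I.walks eq′
      ... | inj₂ (refl , w∈ , _) = subst (Walk G r _) (+-comm a 1)
        (I.walks Pu≡a ++ʷ (Equivalence.to ∈-neighbours w∈ ∷ []))
      L₁⊆ : L₁ ⊆ᴸ labels S₂
      L₁⊆ = subst (L₁ ⊆ᴸ_) (sym E.labels≡) (λ x∈ → x∈)
      u-labelled : (r , [ a ]) ∈ L₁ u
      u-labelled = subst (_ ∈_) (sym (≔-hit L′ u)) (here refl)
      settled′ : ∀ {w p} → State.P S₂ w ≡ [ p ] →
                 w ∈ queue S₂ ⊎ Expanded S₂ w p ⊎ Query r w L ≤⁺ [ p ]
      settled′ eq with E.fresh eq
      ... | inj₂ (_ , _ , w∈) = inj₁ w∈
      ... | inj₁ eq′ with I.settled eq′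
      ...   | inj₁ (there w∈) = inj₁ (E.queued w∈)
      ...   | inj₂ (inj₂ Q≤p) = inj₂ (inj₂ Q≤p)
      ...   | inj₂ (inj₁ (p∈ , next)) = inj₂ (inj₁ (L₁⊆ (L′⊆L₁ p∈) , λ w~x →
              let (p′ , eq″ , le) = next w~x in p′ , E.kept eq″ , le))
      -- The vertex just expanded. Neighbours discovered earlier keep their old distance, and the
      -- frontier bound, hence the FIFO order, keeps it at most `suc a`.
      ...   | inj₁ (here refl) with refl ← []-injective (trans (sym Pu≡a) eq′) =
              inj₂ (inj₁ (L₁⊆ u-labelled , λ u~x →
              let (p′ , eq″) = E.reached (Equivalence.from ∈-neighbours u~x)
              in p′ , eq″ , Frontier.bounded F₂ eq″))

    fold-invariant : ∀ m → Invariant (fold (start r L) (step r L) m)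
    fold-invariant zero    = start-invariant
    fold-invariant (suc m) = step-invariant _ (fold-invariant m)

    -- Outcome of the search.

    open Invariant (fold-invariant n) public

    -- Termination rules out waiting vertices, and soundness of `L` turns a successful pruning test
    -- into an old hub.
    final : ∀ {w p} → P (search r L) w ≡ [ p ] → Expanded (search r L) w p ⊎ Hub A r w p
    final eq with settled eq
    ... | inj₁ w∈          = contradiction (subst (_ ∈_) (search-terminates r L) w∈) λ ()
    ... | inj₂ (inj₁ done) = inj₁ done
    ... | inj₂ (inj₂ Q≤p)  = inj₂ (hub-from-query {L = L} sound Q≤p)

    Reached : V → ℕ → Set
    Reached w a = (∃ λ p → p ≤ a × P (search r L) w ≡ [ p ]) ⊎ Hub A r w a

    reached-step : ∀ {w x a} → Reached w a → w ~ x → Reached x (suc a)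
    reached-step {a = a} (inj₂ h) e =
      inj₂ (hub-mono (≤-reflexive (+-comm a 1)) (hub-extend h (e ∷ [])))
    reached-step (inj₁ (p , p≤a , eq)) e with final eq
    ... | inj₁ (_ , next) = let (p′ , eq′ , le) = next e in inj₁ (p′ , ≤-trans le (s≤s p≤a) , eq′)
    -- The walk meets a pruned vertex: from here on the old hub is carried along it.
    ... | inj₂ h          = reached-step (inj₂ (hub-mono p≤a h)) e

    reached-walk : ∀ {w x a b} → Reached w a → Walk G w x b → Reached x (a + b)
    reached-walk {a = a} R [] = subst (Reached _) (sym (+-identityʳ a)) R
    reached-walk {a = a} R (_∷_ {ℓ = b} e p) =
      subst (Reached _) (sym (+-suc a b)) (reached-walk (reached-step R e) p)

    covers : Covers A r (prunedBFS r L)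
    covers p with reached-walk (inj₁ (0 , z≤n , source)) p
    ... | inj₂ h = inj₂ h
    ... | inj₁ (ℓ , ℓ≤a , eq) with final eq
    ...   | inj₁ (ℓ∈ , _) = inj₁ (ℓ , ℓ≤a , ℓ∈)
    -- The endpoint was discovered in time but was itself pruned.
    ...   | inj₂ h        = inj₂ (hub-mono ℓ≤a h)

  prunedBFS-correct : ∀ {A r L} → Correct A L → Correct (A ∪⟨ r ⟩) (prunedBFS r L)
  prunedBFS-correct {r = r} {L} (sound , complete) =
    labels-sound , covers-complete {L = L} {prunedBFS r L} complete labels-⊇ covers
    where open PrunedSearch r L sound

theorem4p1 : {V : Set} {n : ℕ} (G : Graph V) (order : Fin n ↔ V) →
    let open Labelling G order in
    (k : ℕ) (k≤n : k ≤ n) (s t : V) →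
    Query s t (pruned k k≤n) ≡ Query s t (naive k k≤n)
theorem4p1 G order k k≤n =
  correct-unique {L = pruned k k≤n} {L′ = naive k k≤n}
    (build-correct prunedBFS-correct k k≤n)
    (build-correct addLandmark-correct k k≤n)
  where
  open Labelling G order
  open Correctness G order
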